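{- Let $p_i$ denote the $i$-th prime and, for $n\ge1$, let $$B_n=\prod_{i=1}^{n}p_i^{\lfloor n/i\rfloor}=2^{n}\,3^{\lfloor n/2\rfloor}\,5^{\lfloor n/3\rfloor}\cdots p_n^{\lfloor n/n\rfloor}.$$ Then the sequence $(B_n)_{n\ge1}$ contains only finitely many highly composite numbers.
   Context: A positive integer $N$ is highly composite if $d(m)<d(N)$ for every positive integer $m<N$, where $d$ is the number-of-divisors function. -}

module Defs where

open import Data.Nat.Base
open import Data.Nat.Properties
open import Data.Nat.Divisibility
open import Data.Nat.DivMod using (_/_)
open import Data.Nat.ListAction using (product)
open import Data.Nat.Primality
open import Data.Nat.Primality.Factorisation
open import Data.List.Base using (List; []; _∷_; map; filter; length; upTo)
open import Data.List.Membership.Propositional using (_∈_)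
open import Data.List.Relation.Unary.All using ([]; _∷_)
open import Data.Product.Base using (∃; ∃-syntax; _×_; _,_; proj₁)
open import Function.Bundles using (_⇔_)
open import Level using (Level) renaming (_⊔_ to _⊔ˡ_)
open import Relation.Binary.PropositionalEquality
open import Relation.Nullary using (yes; no; contradiction)
open import Relation.Unary using (Pred)

IsLeastPrimeAbove : ℕ → ℕ → Set
IsLeastPrimeAbove n p = n < p × Prime p × (∀ q → n < q → Prime q → p ≤ q)

primeDivisor : ∀ n → .{{NonTrivial n}} → ∃[ p ] (Prime p × p ∣ n)
primeDivisor n@(2+ _) with factorise n
... | record { factors = [] ; isFactorisation = () }
... | record { factors = p ∷ ps ; isFactorisation = eq ; factorsPrime = pr ∷ _ } =
  p , pr , divides (product ps) (trans eq (*-comm p (product ps)))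

m∣n! : ∀ {m n} → 1 ≤ m → m ≤ n → m ∣ n !
m∣n! {suc m} _ m≤n = ∣-trans (m∣m*n (m !)) (m≤n⇒m!∣n! m≤n)

euclid : ∀ n → ∃[ q ] (n < q × q ≤ suc (n !) × Prime q)
euclid n with primeDivisor (suc (n !)) {{n>1⇒nonTrivial (s≤s (n≢0⇒n>0 (n!≢0′ n)))}}
  where
  n!≢0′ : ∀ k → k ! ≢ 0
  n!≢0′ k = ≢-nonZero⁻¹ (k !) {{k !≢0}}
... | q , pr , q∣ = q , ≰⇒> q≰n , ∣⇒≤ q∣ , pr
  where
  q≰n : q ≰ n
  q≰n q≤n = ¬prime[1] (subst Prime (∣1⇒≡1 q∣1) pr)
    where
    q∣n! : q ∣ n !
    q∣n! = m∣n! (>-nonZero⁻¹ q {{prime⇒nonZero pr}}) q≤n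
    q∣1 : q ∣ 1
    q∣1 = ∣m+n∣m⇒∣n (subst (q ∣_) (+-comm 1 (n !)) q∣) q∣n!

-- The existence hypothesis is used only to justify the last step, so that
-- evaluation never factorises n ! + 1.
search : ∀ n k → ∃[ q ] (n < q × q ≤ suc n + k × Prime q) → ∃ (IsLeastPrimeAbove n)
search n k ex with prime? (suc n)
search n k ex | yes pr = suc n , n<1+n n , pr , λ _ n<q _ → n<q
search n zero (q , n<q , q≤ , pr) | no ¬pr =
  contradiction (subst Prime (≤-antisym (subst (q ≤_) (+-identityʳ (suc n)) q≤) n<q) pr) ¬pr
search n (suc k) (q , n<q , q≤ , pr) | no ¬pr
  with search (suc n) k (q , skip q n<q pr , subst (q ≤_) (+-suc (suc n) k) q≤ , pr)
  where
  skip : ∀ r → n < r → Prime r → suc n < r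
  skip r n<r pr = ≤∧≢⇒< n<r λ { refl → ¬pr pr }
... | p , n<p , prp , least =
  p , <-trans (n<1+n n) n<p , prp ,
  λ r n<r prr → least r (≤∧≢⇒< n<r λ { refl → ¬pr prr }) prr

leastPrimeAbove : ∀ n → ∃ (IsLeastPrimeAbove n)
leastPrimeAbove n with euclid n
... | q , n<q , q≤ , pr = search n (n !) (q , n<q , ≤-trans q≤ (s≤s (m≤n+m (n !) n)) , pr)

nextPrime : ℕ → ℕ
nextPrime n = proj₁ (leastPrimeAbove n)

-- Indexed from zero: nthPrime i is the (i + 1)-th prime.
nthPrime : ℕ → ℕ
nthPrime zero    = nextPrime 0
nthPrime (suc i) = nextPrime (nthPrime i)

B : ℕ → ℕ
B n = product (map (λ i → nthPrime i ^ (n / suc i)) (upTo n))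

divisors : ℕ → List ℕ
divisors n = filter (_∣? n) (map suc (upTo n))

d : ℕ → ℕ
d n = length (divisors n)

HighlyComposite : ℕ → Set
HighlyComposite N = 0 < N × (∀ m → 0 < m → m < N → d m < d N)

Finite : {a ℓ : Level} {A : Set a} → Pred A ℓ → Set (a ⊔ˡ ℓ)
Finite {A = A} P = ∃[ xs ] (∀ (x : A) → x ∈ xs ⇔ P x)

{-# OPTIONS --safe #-}

-- Multiplying B n by 27/32 makes it smaller.  If h = ⌊n/2⌋, this replaces the
-- factor (n + 1)(h + 1) of the divisor count by (n - 4)(h + 4), which is at
-- least as large once h ≥ 17 (as n ≥ 2h).  So B n is not highly composite for
-- n ≥ 34.  The other primes play no role.
module Submission where

open import Defs
open import Data.Nat.Base using (ℕ; _≤_)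
open import Data.Product.Base using (_×_; ∃-syntax)
open import Relation.Binary.PropositionalEquality using (_≡_)

open import Data.Nat.Base
  using (zero; suc; _+_; _*_; _^_; _∸_; _<_; s≤s; z<s; s<s; NonZero; >-nonZero⁻¹; ≢-nonZero; ≢-nonZero⁻¹; _/_)
open import Data.Nat.Properties
open import Data.Nat.Divisibility
open import Data.Nat.DivMod using (n/1≡n; m/n*n≤m; /-monoˡ-≤)
open import Data.Nat.ListAction using (product)
open import Data.Nat.Primality
  using (Prime; euclidsLemma; prime⇒irreducible; prime⇒nonZero; ¬prime[1])
open import Data.Nat.Tactic.RingSolver using (solve-∀)
open import Data.List.Base using (List; []; _∷_; _++_; map; filter; upTo; length; applyUpTo)
open import Data.List.Properties using (length-++; length-map)
open import Data.List.Membership.Propositional using (_∈_)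
open import Data.List.Membership.Propositional.Properties
open import Data.List.Membership.Propositional.Properties.WithK using (unique∧set⇒bag)
open import Data.List.Relation.Binary.BagAndSetEquality using (∼bag⇒↭)
open import Data.List.Relation.Binary.Permutation.Propositional.Properties using (↭-length)
open import Data.List.Relation.Unary.All using (All; []; _∷_)
import Data.List.Relation.Unary.All.Properties as All
open import Data.List.Relation.Unary.Unique.Propositional using (Unique)
import Data.List.Relation.Unary.Unique.Propositional.Properties as Unique
open import Data.Product.Base using (_,_; proj₁; proj₂)
open import Data.Sum.Base using (inj₁; inj₂; [_,_]′)
open import Function.Base using (_∘_)
open import Function.Bundles using (mk⇔)
open import Relation.Binary.PropositionalEquality
  using (refl; sym; trans; cong; subst; module ≡-Reasoning)
open import Relation.Nullary using (¬_; yes; no; contradiction)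
open import Relation.Nullary.Decidable using (_×-dec_; _→-dec_; map′)
open import Relation.Unary using (Decidable)

-- Prime divisors of products and powers.

prime∣prime⇒≡ : ∀ {p q} → Prime p → Prime q → p ∣ q → p ≡ q
prime∣prime⇒≡ pp pq p∣q with prime⇒irreducible pq p∣q
... | inj₁ refl = contradiction pp ¬prime[1]
... | inj₂ p≡q  = p≡q

prime∤1 : ∀ {p} → Prime p → p ∤ 1
prime∤1 pp p∣1 = ¬prime[1] (subst Prime (∣1⇒≡1 p∣1) pp)

prime∤* : ∀ {p m n} → Prime p → p ∤ m → p ∤ n → p ∤ m * n
prime∤* {m = m} {n} pp p∤m p∤n p∣mn = [ p∤m , p∤n ]′ (euclidsLemma m n pp p∣mn)

prime∤^ : ∀ {p m} → Prime p → p ∤ m → ∀ k → p ∤ m ^ k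
prime∤^ pp p∤m zero    = prime∤1 pp
prime∤^ pp p∤m (suc k) = prime∤* pp p∤m (prime∤^ pp p∤m k)

prime∤product : ∀ {p ns} → Prime p → All (p ∤_) ns → p ∤ product ns
prime∤product pp []           = prime∤1 pp
prime∤product pp (p∤n ∷ p∤ns) = prime∤* pp p∤n (prime∤product pp p∤ns)

-- Induction on `k`: Euclid's lemma forces `p` to divide `x`, and cancelling one `p` leaves the same
-- claim for the quotient `x′` and the next lower power.
prime^∣*⇒∣ˡ : ∀ {p} → Prime p → ∀ k {x y} → p ∤ y → p ^ k ∣ x * y → p ^ k ∣ x
prime^∣*⇒∣ˡ         pp zero            p∤y _    = 1∣ _
prime^∣*⇒∣ˡ {p = p} pp (suc k) {x} {y} p∤y pᵏ∣xy
  with euclidsLemma x y pp (∣-trans (m∣m*n (p ^ k)) pᵏ∣xy)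
... | inj₂ p∣y              = contradiction p∣y p∤y
... | inj₁ (divides x′ refl) =
  subst (p * p ^ k ∣_) (*-comm p x′)
    (*-monoʳ-∣ p (prime^∣*⇒∣ˡ pp k p∤y
      (*-cancelˡ-∣ p (subst (p * p ^ k ∣_) (swap x′ p y) pᵏ∣xy))))
  where
  instance _ = prime⇒nonZero pp
  swap : ∀ a b c → a * b * c ≡ b * (a * c)
  swap = solve-∀

-- Counting divisors.

∈-divisors⁻ : ∀ {e} n → e ∈ divisors n → e ∣ n
∈-divisors⁻ n = proj₂ ∘ ∈-filter⁻ (_∣? n) {xs = map suc (upTo n)}

-- `divisors 0` is empty although every number divides 0, hence the `NonZero` instance.
∈-divisors⁺ : ∀ {e} n .{{_ : NonZero n}} → e ∣ n → e ∈ divisors n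
∈-divisors⁺ {zero}  n 0∣n = contradiction (0∣⇒≡0 0∣n) (≢-nonZero⁻¹ n)
∈-divisors⁺ {suc e} n e∣n = ∈-filter⁺ (_∣? n) (∈-map⁺ suc (∈-upTo⁺ (∣⇒≤ e∣n))) e∣n

divisors-unique : ∀ n → Unique (divisors n)
divisors-unique n = Unique.filter⁺ (_∣? n) (Unique.map⁺ suc-injective (Unique.upTo⁺ n))

-- A divisor x of p^(a+1) m with cofactor y divides p^a m if p ∣ y; otherwise
-- p^(a+1) ∣ x.
d-prime-step : ∀ {p} → Prime p → ∀ a m .{{_ : NonZero m}} → p ∤ m →
               d (p ^ suc a * m) ≡ d (p ^ a * m) + d m
d-prime-step {p} pp a m p∤m = begin
  d N
    -- Duplicate-free lists with the same members are permutations of each other, hence equally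
    -- long.
    ≡⟨ ↭-length (∼bag⇒↭ (unique∧set⇒bag (divisors-unique N) unique (mk⇔ to from))) ⟩
  length (divisors M ++ map (q *_) (divisors m))
    ≡⟨ length-++ (divisors M) ⟩
  d M + length (map (q *_) (divisors m))
    ≡⟨ cong (d M +_) (length-map (q *_) (divisors m)) ⟩
  d M + d m ∎
  where
  open ≡-Reasoning
  q = p ^ suc a
  N = q * m
  M = p ^ a * m
  instance
    _ = prime⇒nonZero pp
    pᵃ≢0 = m^n≢0 p a
    q≢0 = m^n≢0 p (suc a)
    M≢0 = m*n≢0 (p ^ a) m
    N≢0 = m*n≢0 q m

  N≡p*M : N ≡ p * M
  N≡p*M = *-assoc p (p ^ a) m

  disjoint : ∀ {x} → ¬ (x ∈ divisors M × x ∈ map (q *_) (divisors m))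
  disjoint (x∈M , x∈q*m) with ∈-map⁻ (q *_) x∈q*m
  -- A common element would make `q` divide `M`; cancelling `p ^ a` leaves `p ∣ m`.
  ... | e , _ , refl = p∤m (*-cancelˡ-∣ (p ^ a)
    (subst (_∣ M) (*-comm p (p ^ a)) (∣-trans (m∣m*n e) (∈-divisors⁻ M x∈M))))

  unique : Unique (divisors M ++ map (q *_) (divisors m))
  unique = Unique.++⁺ (divisors-unique M)
    (Unique.map⁺ (*-cancelˡ-≡ _ _ q) (divisors-unique m)) disjoint

  to : ∀ {x} → x ∈ divisors N → x ∈ divisors M ++ map (q *_) (divisors m)
  to {x} x∈N with ∈-divisors⁻ N x∈N
  ... | divides y N≡yx with p ∣? y
  ...   | yes (divides y′ refl) = ∈-++⁺ˡ (∈-divisors⁺ M (divides y′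
    (*-cancelˡ-≡ M (y′ * x) p (begin
      p * M        ≡⟨ N≡p*M ⟨
      N            ≡⟨ N≡yx ⟩
      y′ * p * x   ≡⟨ cong (_* x) (*-comm y′ p) ⟩
      p * y′ * x   ≡⟨ *-assoc p y′ x ⟩
      p * (y′ * x) ∎))))
  ...   | no p∤y with prime^∣*⇒∣ˡ pp (suc a) {x} {y} p∤y
                        (subst (q ∣_) (trans N≡yx (*-comm y x)) (m∣m*n m))
  ...     | divides e refl = ∈-++⁺ʳ (divisors M)
    (subst (_∈ map (q *_) (divisors m)) (*-comm q e)
      (∈-map⁺ (q *_) (∈-divisors⁺ m (*-cancelˡ-∣ q
        (subst (_∣ N) (*-comm e q) (divides y N≡yx))))))

  from : ∀ {x} → x ∈ divisors M ++ map (q *_) (divisors m) → x ∈ divisors N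
  from {x} x∈ with ∈-++⁻ (divisors M) x∈
  ... | inj₁ x∈M = ∈-divisors⁺ N
    (subst (x ∣_) (sym N≡p*M) (∣n⇒∣m*n p (∈-divisors⁻ M x∈M)))
  ... | inj₂ x∈q*m with ∈-map⁻ (q *_) x∈q*m
  ...   | e , e∈m , refl = ∈-divisors⁺ N (*-monoʳ-∣ q (∈-divisors⁻ m e∈m))

-- Each further factor `p` contributes one more `d m`. This is multiplicativity of `d` in the one
-- case needed.
d-prime^* : ∀ {p} → Prime p → ∀ a m .{{_ : NonZero m}} → p ∤ m →
            d (p ^ a * m) ≡ suc a * d m
d-prime^* pp zero    m p∤m = trans (cong d (*-identityˡ m)) (sym (*-identityˡ (d m)))
d-prime^* {p} pp (suc a) m p∤m = begin
  d (p ^ suc a * m)     ≡⟨ d-prime-step pp a m p∤m ⟩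
  d (p ^ a * m) + d m   ≡⟨ cong (_+ d m) (d-prime^* pp a m p∤m) ⟩
  suc a * d m + d m     ≡⟨ +-comm (suc a * d m) (d m) ⟩
  suc (suc a) * d m     ∎
  where open ≡-Reasoning

-- The sequence of primes.

nextPrime-prime : ∀ n → Prime (nextPrime n)
nextPrime-prime n = proj₁ (proj₂ (proj₂ (leastPrimeAbove n)))

n<nextPrime : ∀ n → n < nextPrime n
n<nextPrime n = proj₁ (proj₂ (leastPrimeAbove n))

nthPrime-prime : ∀ i → Prime (nthPrime i)
nthPrime-prime zero    = nextPrime-prime 0
nthPrime-prime (suc i) = nextPrime-prime (nthPrime i)

nthPrime-mono-< : ∀ {i j} → i < j → nthPrime i < nthPrime j
nthPrime-mono-< {i} {suc j} i<1+j with m<1+n⇒m<n∨m≡n i<1+j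
... | inj₁ i<j  = <-trans (nthPrime-mono-< i<j) (n<nextPrime (nthPrime j))
... | inj₂ refl = n<nextPrime (nthPrime j)

nthPrime∤nthPrime^ : ∀ {i j} → i < j → ∀ k → nthPrime i ∤ nthPrime j ^ k
nthPrime∤nthPrime^ {i} {j} i<j = prime∤^ (nthPrime-prime i)
  (<⇒≢ (nthPrime-mono-< i<j) ∘ prime∣prime⇒≡ (nthPrime-prime i) (nthPrime-prime j))

-- Splitting off the powers of 2 and 3.

-- Two separate non-divisibilities, the form in which `d-prime^*` takes its hypothesis.
record CoprimeTo6 (m : ℕ) : Set where
  constructor coprimeTo6
  field
    2∤ : 2 ∤ m
    3∤ : 3 ∤ m

  nonZero : NonZero m
  nonZero = ≢-nonZero (λ { refl → 2∤ (2 ∣0) })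

d-2^a*3^b*m : ∀ a b {m} → CoprimeTo6 m → d (2 ^ a * (3 ^ b * m)) ≡ suc a * (suc b * d m)
d-2^a*3^b*m a b {m} (coprimeTo6 2∤m 3∤m) = trans
  -- `nthPrime 0` and `nthPrime 1` evaluate to 2 and 3, so facts about the prime sequence apply to
  -- the literals.
  (d-prime^* (nthPrime-prime 0) a (3 ^ b * m)
    (prime∤* (nthPrime-prime 0) (nthPrime∤nthPrime^ {0} {1} z<s b) 2∤m))
  (cong (suc a *_) (d-prime^* (nthPrime-prime 1) b m 3∤m))
  where
  instance
    m≢0 = CoprimeTo6.nonZero (coprimeTo6 2∤m 3∤m)
    3ᵇ≢0 = m^n≢0 3 b
    3ᵇm≢0 = m*n≢0 (3 ^ b) m

-- For `2 ≤ n` the product begins with the powers of 2 and 3; the remaining factors are powers of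
-- later primes, and their product serves as `r`.
B-decomposition : ∀ {n} → 2 ≤ n → ∃[ r ] (CoprimeTo6 r × B n ≡ 2 ^ n * (3 ^ (n / 2) * r))
B-decomposition {suc zero}        (s≤s ())
B-decomposition {n@(suc (suc k))} _ =
  product (map power tail) ,
  coprimeTo6 (∤tail {0} z<s) (∤tail {1} (s<s z<s)) ,
  -- `B n` unfolds to this shape by computation, `tail` being what `upTo n` leaves after two
  -- entries; only the exponent `n / 1` of 2 needs rewriting.
  cong (λ a → 2 ^ a * (3 ^ (n / 2) * product (map power tail))) (n/1≡n n)
  where
  power : ℕ → ℕ
  power i = nthPrime i ^ (n / suc i)
  tail : List ℕ
  tail = applyUpTo (λ i → suc (suc i)) k
  ∤tail : ∀ {i} → i < 2 → nthPrime i ∤ product (map power tail)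
  ∤tail {i} i<2 = prime∤product (nthPrime-prime i) (All.map⁺ (All.applyUpTo⁺₂ _ k
    (λ j → nthPrime∤nthPrime^ (<-≤-trans i<2 (m≤m+n 2 j)) (n / suc (suc (suc j))))))

-- Exchanging five factors 2 for three factors 3.

exchange-< : ∀ a b m .{{_ : NonZero m}} →
             2 ^ a * (3 ^ (3 + b) * m) < 2 ^ (5 + a) * (3 ^ b * m)
exchange-< a b m = begin-strict
  2 ^ a * (3 ^ (3 + b) * m)  ≡⟨ lhs (2 ^ a) (3 ^ b) m ⟩
  -- Here 27 is 3 ^ 3 and 32 is 2 ^ 5; `27 < 32` unfolds to `28 ≤ 28 + 4`.
  K * 27                     <⟨ *-monoʳ-< K {27} {32} (m≤m+n 28 4) ⟩
  K * 32                     ≡⟨ rhs (2 ^ a) (3 ^ b) m ⟨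
  2 ^ (5 + a) * (3 ^ b * m)  ∎
  where
  open ≤-Reasoning
  K = 2 ^ a * (3 ^ b * m)
  instance
    2ᵃ≢0 = m^n≢0 2 a
    3ᵇ≢0 = m^n≢0 3 b
    3ᵇm≢0 = m*n≢0 (3 ^ b) m
    K≢0 = m*n≢0 (2 ^ a) (3 ^ b * m)
  lhs : ∀ x y m → x * ((3 * (3 * (3 * y))) * m) ≡ x * (y * m) * 27
  lhs = solve-∀
  rhs : ∀ x y m → (2 * (2 * (2 * (2 * (2 * x))))) * (y * m) ≡ x * (y * m) * 32
  rhs = solve-∀

-- 15 is added to both sides to avoid the subtraction in 2b - 5 ≤ a.
exchange-d : ∀ {a b} → 17 ≤ b → b * 2 ≤ 5 + a → (6 + a) * (1 + b) ≤ (1 + a) * (4 + b)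
exchange-d {a} {b} 17≤b 2b≤5+a = +-cancelˡ-≤ 15 _ _ (begin
  15 + (6 + a) * (1 + b)  ≡⟨ lhs a b ⟩
  c + (17 + b * 5)        ≤⟨ +-monoʳ-≤ c (+-monoˡ-≤ (b * 5) 17≤b) ⟩
  c + (b + b * 5)         ≡⟨ cong (c +_) (mid b) ⟩
  c + 3 * (b * 2)         ≤⟨ +-monoʳ-≤ c (*-monoʳ-≤ 3 2b≤5+a) ⟩
  c + 3 * (5 + a)         ≡⟨ rhs a b ⟩
  15 + (1 + a) * (4 + b)  ∎)
  where
  open ≤-Reasoning
  c = 4 + a * b + a + b
  lhs : ∀ a b → 15 + (6 + a) * (1 + b) ≡ (4 + a * b + a + b) + (17 + b * 5)
  lhs = solve-∀
  mid : ∀ b → b + b * 5 ≡ 3 * (b * 2)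
  mid = solve-∀
  rhs : ∀ a b → (4 + a * b + a + b) + 3 * (5 + a) ≡ 15 + (1 + a) * (4 + b)
  rhs = solve-∀

-- The smaller number `M` has at least as many divisors as `N`: both counts are multiples of `d m`,
-- and `exchange-d` compares the coefficients. Writing the exponent of 2 as `5 + a` keeps
-- subtraction out of `M`.
¬highlyComposite-2^a*3^b*m : ∀ {a b m} → CoprimeTo6 m → 17 ≤ b → b * 2 ≤ 5 + a →
                             ¬ HighlyComposite (2 ^ (5 + a) * (3 ^ b * m))
¬highlyComposite-2^a*3^b*m {a} {b} {m} co 17≤b 2b≤5+a (_ , d-max) =
  <⇒≱ (d-max M (>-nonZero⁻¹ M) (exchange-< a b m)) (begin
    d N                        ≡⟨ d-2^a*3^b*m (5 + a) b co ⟩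
    (6 + a) * ((1 + b) * d m)  ≡⟨ *-assoc (6 + a) (1 + b) (d m) ⟨
    (6 + a) * (1 + b) * d m    ≤⟨ *-monoˡ-≤ (d m) (exchange-d 17≤b 2b≤5+a) ⟩
    (1 + a) * (4 + b) * d m    ≡⟨ *-assoc (1 + a) (4 + b) (d m) ⟩
    (1 + a) * ((4 + b) * d m)  ≡⟨ d-2^a*3^b*m a (3 + b) co ⟨
    d M                        ∎)
  where
  open ≤-Reasoning
  M = 2 ^ a * (3 ^ (3 + b) * m)
  N = 2 ^ (5 + a) * (3 ^ b * m)
  instance
    m≢0 = CoprimeTo6.nonZero co
    2ᵃ≢0 = m^n≢0 2 a
    3ᵇ≢0 = m^n≢0 3 (3 + b)
    3ᵇm≢0 = m*n≢0 (3 ^ (3 + b)) m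
    M≢0 = m*n≢0 (2 ^ a) (3 ^ (3 + b) * m)

¬highlyComposite-B : ∀ {n} → 34 ≤ n → ¬ HighlyComposite (B n)
¬highlyComposite-B {n} 34≤n hc =
  let r , co , Bn≡ = B-decomposition (≤-trans (m≤m+n 2 32) 34≤n)
      -- Truncated subtraction is exact because `5 ≤ n`.
      5+a≡n = m+[n∸m]≡n (≤-trans (m≤m+n 5 29) 34≤n)
  in ¬highlyComposite-2^a*3^b*m {n ∸ 5} {n / 2} co
       -- `34 / 2` evaluates to 17, the bound required of the exponent of 3.
       (/-monoˡ-≤ {34} {n} 2 34≤n)
       (subst (n / 2 * 2 ≤_) (sym 5+a≡n) (m/n*n≤m n 2))
       (subst HighlyComposite
         (trans Bn≡ (cong (λ k → 2 ^ k * (3 ^ (n / 2) * r)) (sym 5+a≡n))) hc)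

-- Decidability and finiteness.

-- The quantifier over `m` is bounded by `N`, so finitely many checks suffice; `map′` only reorders
-- hypotheses to suit `allUpTo?`.
highlyComposite? : Decidable HighlyComposite
highlyComposite? N = (0 <? N) ×-dec
  map′ (λ f m 0<m m<N → f m<N 0<m) (λ f {m} m<N 0<m → f m 0<m m<N)
       (allUpTo? (λ m → (0 <? m) →-dec (d m <? d N)) N)

-- `Finite` demands a list with exactly the right members, so a bound on `n` is not enough:
-- decidability of `P` serves to filter the candidates.
finite-positive-image : ∀ {P : ℕ → Set} → Decidable P → (f : ℕ → ℕ) → ∀ b →
                        (∀ {n} → b ≤ n → ¬ P (f n)) →
                        Finite (λ N → P N × (∃[ n ] (1 ≤ n × N ≡ f n)))
finite-positive-image {P} P? f b ¬Pf = filter P? candidates , λ N → mk⇔ to from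
  where
  candidates : List ℕ
  -- The values of `f` at 1 up to `b`; the shift by `suc` matches `1 ≤ n`.
  candidates = map (f ∘ suc) (upTo b)

  to : ∀ {N} → N ∈ filter P? candidates → P N × (∃[ n ] (1 ≤ n × N ≡ f n))
  to N∈ with ∈-filter⁻ P? {xs = candidates} N∈
  ... | N∈candidates , PN with ∈-map⁻ (f ∘ suc) N∈candidates
  ...   | i , _ , N≡ = PN , suc i , z<s , N≡

  from : ∀ {N} → P N × (∃[ n ] (1 ≤ n × N ≡ f n)) → N ∈ filter P? candidates
  from (PN , suc i , _ , refl) with i <? b
  ... | yes i<b = ∈-filter⁺ P? (∈-map⁺ (f ∘ suc) (∈-upTo⁺ i<b)) PN
  ... | no  i≮b = contradiction PN (¬Pf (m≤n⇒m≤1+n (≮⇒≥ i≮b)))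

proposition54 : Finite (λ (N : ℕ) → HighlyComposite N × (∃[ n ] (1 ≤ n × N ≡ B n)))
proposition54 = finite-positive-image highlyComposite? B 34 ¬highlyComposite-B
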